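{- Let $G$ be a bicyclic graph with diameter $3$. Then $G$ is group vertex magic if and only if $G$ is isomorphic to $M_{11}(0,0)$, the graph on vertices $v_1,\dots,v_7$ consisting of the $5$-cycle $v_1v_2v_3v_4v_5v_1$ and the triangle $v_1v_6v_7$ (i.e. a $C_5$ and a $C_3$ sharing exactly one vertex, with no further vertices or edges).
   Context: All graphs are finite, simple and undirected. A bicyclic graph is a connected graph with $|E(G)|=|V(G)|+1$. For an additive abelian group $\mathcal{A}$ with identity $0$, a map $\ell:V(G)\to\mathcal{A}\setminus\{0\}$ is an $\mathcal{A}$-vertex magic labeling if there is $\mu\in\mathcal{A}$ with $\omega(v)=\sum_{u\in N(v)}\ell(u)=\mu$ for every vertex $v$ (where $N(v)$ is the set of neighbours of $v$); $G$ is $\mathcal{A}$-vertex magic if it admits such a labeling, and $G$ is group vertex magic if it is $\mathcal{A}$-vertex magic for every nontrivial abelian group $\mathcal{A}$. -}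

module Defs where

open import Algebra.Bundles using (AbelianGroup)
open import Data.Bool using (Bool; false; T; _∨_)
open import Data.Bool.Properties using (T?) renaming (_≟_ to _≟ᵇ_)
open import Data.Fin using (Fin; #_)
open import Data.Fin.Properties using (_≟_; _<?_; all?)
open import Data.List using (List; []; _∷_; length; filter; foldr; map; allFin; cartesianProduct)
open import Data.Nat using (ℕ; suc; _≤_)
open import Data.Product using (Σ; ∃-syntax; _×_; _,_)
open import Data.Product.Properties using (≡-dec)
open import Function.Bundles using (_↔_; Inverse)
open import Level using (Level; _⊔_) renaming (suc to lsuc)
open import Relation.Binary.PropositionalEquality using (_≡_)
open import Relation.Nullary using (¬_; does)
open import Relation.Nullary.Decidable using (_×-dec_; toWitness)

import Data.List.Membership.DecPropositional as DecMembership

record Graph : Set where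
  field
    order      : ℕ
    adj        : Fin order → Fin order → Bool
    adj-sym    : ∀ u v → adj u v ≡ adj v u
    adj-irrefl : ∀ v → adj v v ≡ false

  Vertex : Set
  Vertex = Fin order

  Adj : Vertex → Vertex → Set
  Adj u v = T (adj u v)

  neighbours : Vertex → List Vertex
  neighbours v = filter (λ u → T? (adj v u)) (allFin order)

  -- Each undirected edge is listed once, as the pair with its smaller endpoint first.
  edges : List (Vertex × Vertex)
  edges = filter (λ (u , v) → (u <? v) ×-dec T? (adj u v))
                 (cartesianProduct (allFin order) (allFin order))

  size : ℕ
  size = length edges

  data Walk : Vertex → Vertex → ℕ → Set where
    nil  : ∀ {v} → Walk v v 0
    cons : ∀ {u v w k} → Adj u v → Walk v w k → Walk u w (suc k)

  -- The empty graph counts as connected here; it has no edges, so it is never bicyclic.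
  Connected : Set
  Connected = ∀ u v → ∃[ k ] Walk u v k

  IsDistance : Vertex → Vertex → ℕ → Set
  IsDistance u v d = Walk u v d × (∀ k → Walk u v k → d ≤ k)

  HasDiameter : ℕ → Set
  HasDiameter d =
    (∀ u v → ∃[ k ] (IsDistance u v k × k ≤ d)) × (∃[ u ] ∃[ v ] IsDistance u v d)

  Bicyclic : Set
  Bicyclic = Connected × size ≡ suc order

open Graph public using (Bicyclic; HasDiameter)

infix 4 _≅_

_≅_ : Graph → Graph → Set
G ≅ H = Σ (G.Vertex ↔ H.Vertex) λ f →
          ∀ u v → G.adj u v ≡ H.adj (Inverse.to f u) (Inverse.to f v)
  where
  module G = Graph G
  module H = Graph H

module _ {c ℓ : Level} (A : AbelianGroup c ℓ) where
  open AbelianGroup A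

  Nontrivial : Set (c ⊔ ℓ)
  Nontrivial = ∃[ a ] ¬ (a ≈ ε)

  weight : (G : Graph) → (Graph.Vertex G → Carrier) → Graph.Vertex G → Carrier
  weight G l v = foldr _∙_ ε (map l (Graph.neighbours G v))

  IsVertexMagicLabeling : (G : Graph) → (Graph.Vertex G → Carrier) → Set (c ⊔ ℓ)
  IsVertexMagicLabeling G l =
    (∀ v → ¬ (l v ≈ ε)) × (∃[ μ ] (∀ v → weight G l v ≈ μ))

  VertexMagic : Graph → Set (c ⊔ ℓ)
  VertexMagic G = ∃[ l ] IsVertexMagicLabeling G l

GroupVertexMagic : (c ℓ : Level) → Graph → Set (lsuc (c ⊔ ℓ))
GroupVertexMagic c ℓ G = (A : AbelianGroup c ℓ) → Nontrivial A → VertexMagic A G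

-- The vertex vᵢ is # (i - 1).
M₁₁-edges : List (Fin 7 × Fin 7)
M₁₁-edges =
  (# 0 , # 1) ∷ (# 1 , # 2) ∷ (# 2 , # 3) ∷ (# 3 , # 4) ∷ (# 4 , # 0) ∷
  (# 0 , # 5) ∷ (# 5 , # 6) ∷ (# 6 , # 0) ∷ []

M₁₁-adj : Fin 7 → Fin 7 → Bool
M₁₁-adj u v = does ((u , v) ∈? M₁₁-edges) ∨ does ((v , u) ∈? M₁₁-edges)
  where open DecMembership (≡-dec (_≟_ {7}) (_≟_ {7})) using (_∈?_)

M₁₁⟨0,0⟩ : Graph
M₁₁⟨0,0⟩ = record
  { order      = 7
  ; adj        = M₁₁-adj
  ; adj-sym    = toWitness {a? = all? λ u → all? λ v → M₁₁-adj u v ≟ᵇ M₁₁-adj v u} _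
  ; adj-irrefl = toWitness {a? = all? λ v → M₁₁-adj v v ≟ᵇ false} _
  }

{-# OPTIONS --safe #-}
-- Magic over ℤ/2, where every label is 1, says that all degrees have the same parity.
--
-- Odd degrees: the degree sum 2n + 2 forces a leaf, and its support x is within distance 2 of
-- every vertex, so G is a spanning tree of depth 2 rooted at x plus two extra edges. Let u lie
-- on the first extra edge only and v on the second only. By parity both have a child that is a
-- leaf of G, and since these leaves are within distance 3, u and v are adjacent; but then uv
-- would be a third extra edge.
--
-- Even degrees: there is one vertex w of degree 4 and all others have degree 2, so G consists
-- of two cycles through w. The diameter leaves only a triangle with a 4-cycle or a 5-cycle, and
-- the 4-cycle is excluded by labelings in ℤ. Conversely, on M₁₁(0,0) the labels a at v₁, v₂, v₅
-- and −a elsewhere give weight 0 everywhere.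
module Submission where

open import Defs
open import Function.Bundles using (_⇔_)
open import Level using (Level)

open import Algebra.Bundles using (AbelianGroup; CommutativeRing)
import Algebra.Properties.AbelianGroup as AbelianGroupProperties
open import Data.Bool using (Bool; true; false; T; not; _∧_; _∨_; _xor_; if_then_else_)
open import Data.Bool.Properties using (T?; T-∧; ∧-comm; ∧-identityʳ; xor-∧-commutativeRing; ¬-not; not-involutive)
open import Data.Empty using (⊥; ⊥-elim)
open import Data.Fin using (Fin; zero; suc) renaming (_<_ to _<ᶠ_)
open import Data.Fin.Patterns
open import Data.Fin.Properties using (_≟_; _<?_; <-cmp; any?)
open import Data.Integer as ℤ using ()
import Data.Integer.Properties as ℤ
open import Data.List using (List; []; _∷_; _++_; length; filter; foldr; map; allFin; tabulate; cartesianProduct; lookup)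
import Data.List.Membership.DecPropositional as DecMembership
open import Data.List.Membership.Propositional using (_∈_)
open import Data.List.Membership.Propositional.Properties using (∈-filter⁺; ∈-filter⁻; ∈-allFin; ∈-map⁺; ∈-map⁻; ∈-cartesianProduct⁺; ∈-∃++; ∈-lookup)
open import Data.List.Membership.Propositional.Properties.WithK using (unique∧set⇒bag)
open import Data.List.Properties using (filter-++; length-++; length-filter; length-tabulate; map-tabulate; map-∘)
open import Data.List.Relation.Binary.BagAndSetEquality using (∼bag⇒↭)
open import Data.List.Relation.Binary.Permutation.Propositional using (_↭_; prep; swap; ↭-sym; ↭-trans; ↭⇒↭ₛ)
open import Data.List.Relation.Binary.Permutation.Propositional.Properties using (∈-resp-↭; ↭-length; shift)
import Data.List.Relation.Binary.Permutation.Setoid.Properties as PermSetoid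
open import Data.List.Relation.Unary.All as All using (All; []; _∷_)
open import Data.List.Relation.Unary.AllPairs using ([]; _∷_)
open import Data.List.Relation.Unary.Any using (here; there)
open import Data.List.Relation.Unary.Unique.Propositional using (Unique)
open import Data.List.Relation.Unary.Unique.Propositional.Properties using (filter⁺; allFin⁺; cartesianProduct⁺) renaming (map⁺ to Unique-map⁺)
open import Data.Nat using (ℕ; zero; suc; _+_; _*_; _≤_; z≤n; s≤s)
open import Data.Nat.Properties hiding (_<?_; <-cmp) renaming (_≟_ to _≟ⁿ_)
open import Data.Nat.Solver using (module +-*-Solver)
open import Data.Product using (∃-syntax; _×_; _,_; proj₁; proj₂)
open import Data.Product.Properties using (≡-dec)
open import Data.Sum using (_⊎_; inj₁; inj₂; [_,_]′) renaming (swap to swap-⊎)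
open import Data.Unit using (tt)
open import Function using (_∘_; id; case_of_)
open import Function.Bundles using (mk⇔; mk↔ₛ′; Inverse; Equivalence)
open import Level using (Lift; lift; lower; 0ℓ)
open import Relation.Binary using (tri<; tri≈; tri>)
open import Relation.Binary.PropositionalEquality
open import Relation.Nullary using (¬_; Dec; yes; no; does; contradiction)
open import Relation.Nullary.Decidable using (_×-dec_)
open import Relation.Unary using (Pred; Decidable)
open import Algebra.Properties.CommutativeMonoid.Sum +-0-commutativeMonoid using (sum; sum-syntax; sum-cong-≗; ∑-distrib-+; ∑-comm; sum-replicate-zero)

-- Finite sums and counting.

ind : Bool → ℕ
ind b = if b then 1 else 0

sum-const : ∀ n k → ∑[ i < n ] k ≡ n * k
sum-const zero    k = refl
sum-const (suc n) k = cong (k +_) (sum-const n k)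

sum-mono : ∀ {n} {f g : Fin n → ℕ} → (∀ i → f i ≤ g i) → sum f ≤ sum g
sum-mono {zero}  f≤g = z≤n
sum-mono {suc n} f≤g = +-mono-≤ (f≤g 0F) (sum-mono (f≤g ∘ suc))

sum≡0⇒≡0 : ∀ {n} (f : Fin n → ℕ) → sum f ≡ 0 → ∀ i → f i ≡ 0
sum≡0⇒≡0 {suc n} f eq zero    = m+n≡0⇒m≡0 (f 0F) eq
sum≡0⇒≡0 {suc n} f eq (suc i) = sum≡0⇒≡0 (f ∘ suc) (m+n≡0⇒n≡0 (f 0F) eq) i

sum≢0⇒∃≢0 : ∀ {n} (f : Fin n → ℕ) → sum f ≢ 0 → ∃[ i ] f i ≢ 0
sum≢0⇒∃≢0 {zero}  f ≢0 = contradiction refl ≢0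
sum≢0⇒∃≢0 {suc n} f ≢0 with f 0F in eq
... | suc _ = 0F , λ f0≡0 → contradiction (trans (sym eq) f0≡0) λ ()
... | zero  = let i , fi≢0 = sum≢0⇒∃≢0 (f ∘ suc) ≢0 in suc i , fi≢0

sum≡1⇒∃!1 : ∀ {n} (f : Fin n → ℕ) → sum f ≡ 1 → ∃[ i ] f i ≡ 1 × (∀ j → j ≢ i → f j ≡ 0)
sum≡1⇒∃!1 {suc n} f eq with f 0F in f0
... | zero =
  let i , fi , rest = sum≡1⇒∃!1 (f ∘ suc) eq
  in suc i , fi , λ { zero _ → f0 ; (suc j) j≢i → rest j (j≢i ∘ cong suc) }
... | suc zero =
  0F , f0 , λ { zero 0≢0 → contradiction refl 0≢0
              ; (suc j) _ → sum≡0⇒≡0 (f ∘ suc) (suc-injective eq) j }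

sum-ind-≟ : ∀ {n} (x : Fin n) → ∑[ i < n ] ind (does (x ≟ i)) ≡ 1
sum-ind-≟ {suc n} zero    = cong suc (sum-replicate-zero n)
sum-ind-≟ {suc n} (suc x) = sum-ind-≟ x

module _ {A : Set} {p} {P : Pred A p} (P? : Decidable P) where

  length-filter-tabulate : ∀ {n} (f : Fin n → A) →
    length (filter P? (tabulate f)) ≡ ∑[ i < n ] ind (does (P? (f i)))
  length-filter-tabulate {zero}  f = refl
  length-filter-tabulate {suc n} f with does (P? (f 0F))
  ... | true  = cong suc (length-filter-tabulate (f ∘ suc))
  ... | false = length-filter-tabulate (f ∘ suc)

-- Edges are listed by filtering a product, so this turns `size` into a double sum of indicators,
-- where `handshake` can exchange the order of summation.
length-filter-product : ∀ {A B : Set} {p} {P : Pred (A × B) p} (P? : Decidable P) →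
  ∀ {m n} (f : Fin m → A) (g : Fin n → B) →
  length (filter P? (cartesianProduct (tabulate f) (tabulate g))) ≡
  ∑[ i < m ] ∑[ j < n ] ind (does (P? (f i , g j)))
length-filter-product P? {zero}  f g = refl
length-filter-product P? {suc m} f g = begin
  length (filter P? (map (f 0F ,_) (tabulate g) ++ rest))
    ≡⟨ cong length (filter-++ P? (map (f 0F ,_) (tabulate g)) rest) ⟩
  length (filter P? (map (f 0F ,_) (tabulate g)) ++ filter P? rest)
    ≡⟨ length-++ (filter P? (map (f 0F ,_) (tabulate g))) ⟩
  length (filter P? (map (f 0F ,_) (tabulate g))) + length (filter P? rest)
    ≡⟨ cong₂ _+_
         (trans (cong (length ∘ filter P?) (map-tabulate g (f 0F ,_)))
                (length-filter-tabulate P? (λ j → f 0F , g j)))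
         (length-filter-product P? (f ∘ suc) g) ⟩
  _ ∎
  where
  open ≡-Reasoning
  rest = cartesianProduct (tabulate (f ∘ suc)) (tabulate g)

-- A weight in an abelian group does not depend on the order of its summands, so neighbourhoods need
-- only be known up to `↭`.
unique∧set⇒↭ : ∀ {A : Set} {xs ys : List A} → Unique xs → Unique ys →
  (∀ {z} → z ∈ xs → z ∈ ys) → (∀ {z} → z ∈ ys → z ∈ xs) → xs ↭ ys
unique∧set⇒↭ uxs uys to from = ∼bag⇒↭ (unique∧set⇒bag uxs uys (mk⇔ to from))

Unique-resp-↭ : ∀ {A : Set} {xs ys : List A} → xs ↭ ys → Unique xs → Unique ys
Unique-resp-↭ {A} p = PermSetoid.Unique-resp-↭ (setoid A) (↭⇒↭ₛ p)

-- Degrees, edges and short walks.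

module GraphProperties (G : Graph) where
  open Graph G public hiding (HasDiameter; Bicyclic)

  Adj-sym : ∀ {u v} → Adj u v → Adj v u
  Adj-sym {u} {v} = subst T (adj-sym u v)

  Adj⇒≢ : ∀ {u v} → Adj u v → u ≢ v
  Adj⇒≢ {u} uv refl = subst T (adj-irrefl u) uv

  ∈-neighbours⁺ : ∀ {u v} → Adj u v → v ∈ neighbours u
  ∈-neighbours⁺ {u} uv = ∈-filter⁺ (λ z → T? (adj u z)) (∈-allFin _) uv

  ∈-neighbours⁻ : ∀ {u v} → v ∈ neighbours u → Adj u v
  ∈-neighbours⁻ {u} v∈ = proj₂ (∈-filter⁻ (λ z → T? (adj u z)) {xs = allFin order} v∈)

  neighbours-unique : ∀ v → Unique (neighbours v)
  neighbours-unique v = filter⁺ (λ z → T? (adj v z)) (allFin⁺ order)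

  degree : Vertex → ℕ
  degree v = length (neighbours v)

  degree-sum : ∀ v → degree v ≡ ∑[ u < order ] ind (adj v u)
  degree-sum v = length-filter-tabulate (λ z → T? (adj v z)) id

  degree≤order : ∀ v → degree v ≤ order
  degree≤order v = subst (degree v ≤_) (length-tabulate id)
    (length-filter (λ z → T? (adj v z)) (allFin order))

  -- By `split`, each adjacency is attributed to the order of its endpoints; the two resulting
  -- double sums differ by exchanging the summations, and each is `size`.
  handshake : ∑[ v < order ] degree v ≡ size + size
  handshake = begin
    ∑[ u < order ] degree u
      ≡⟨ sum-cong-≗ (λ u → trans (degree-sum u) (trans (sum-cong-≗ (split u)) (∑-distrib-+ {order} _ _))) ⟩
    ∑[ u < order ] (∑[ v < order ] ordered u v + ∑[ v < order ] ordered v u)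
      ≡⟨ ∑-distrib-+ {order} _ _ ⟩
    ∑[ u < order ] ∑[ v < order ] ordered u v + ∑[ u < order ] ∑[ v < order ] ordered v u
      ≡⟨ cong (∑[ u < order ] ∑[ v < order ] ordered u v +_) (∑-comm (λ u v → ordered v u)) ⟩
    ∑[ u < order ] ∑[ v < order ] ordered u v + ∑[ u < order ] ∑[ v < order ] ordered u v
      ≡⟨ sym (cong₂ _+_ size-sum size-sum) ⟩
    size + size ∎
    where
    open ≡-Reasoning
    ordered : Vertex → Vertex → ℕ
    ordered u v = ind (does (u <? v) ∧ adj u v)
    size-sum : size ≡ ∑[ u < order ] ∑[ v < order ] ordered u v
    size-sum = length-filter-product (λ (u , v) → (u <? v) ×-dec T? (adj u v)) {order} {order} id id
    split′ : ∀ u v (u<?v : Dec (u <ᶠ v)) (v<?u : Dec (v <ᶠ u)) →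
      ind (adj u v) ≡ ind (does u<?v ∧ adj u v) + ind (does v<?u ∧ adj v u)
    split′ u v (yes u<v) (yes v<u) = contradiction v<u (<-asym u<v)
    split′ u v (yes _)   (no _)    = sym (+-identityʳ _)
    split′ u v (no _)    (yes _)   = cong ind (adj-sym u v)
    split′ u v (no u≮v)  (no v≮u) with <-cmp u v
    ... | tri< u<v _ _  = contradiction u<v u≮v
    ... | tri≈ _ refl _ = cong ind (adj-irrefl u)
    ... | tri> _ _ v<u  = contradiction v<u v≮u
    split : ∀ u v → ind (adj u v) ≡ ordered u v + ordered v u
    split u v = split′ u v (u <? v) (v <? u)

  neighbours-↭ : ∀ {v xs} → Unique xs → (∀ {z} → Adj v z → z ∈ xs) → (∀ {z} → z ∈ xs → Adj v z) →
    neighbours v ↭ xs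
  neighbours-↭ {v} uxs to from =
    unique∧set⇒↭ (neighbours-unique v) uxs (to ∘ ∈-neighbours⁻) (∈-neighbours⁺ ∘ from)

  degree≡1 : ∀ {v u} → Adj v u → (∀ {z} → Adj v z → z ≡ u) → degree v ≡ 1
  degree≡1 vu only = ↭-length (neighbours-↭ ([] ∷ []) (here ∘ only) λ { (here refl) → vu })

  degree≡1⇒∃! : ∀ {v} → degree v ≡ 1 → ∃[ u ] Adj v u × (∀ {z} → Adj v z → z ≡ u)
  degree≡1⇒∃! {v} eq with neighbours v in nv
  ... | u ∷ [] = u , ∈-neighbours⁻ (subst (u ∈_) (sym nv) (here refl)) , λ vz →
    case subst (_ ∈_) nv (∈-neighbours⁺ vz) of λ { (here z≡u) → z≡u }

  degree≡0⇒¬Adj : ∀ {v z} → degree v ≡ 0 → ¬ Adj v z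
  degree≡0⇒¬Adj {v} eq vz with neighbours v | ∈-neighbours⁺ vz
  ... | [] | ()

  -- A walk of length at most 3 with its inner vertices named. Minimality is dropped, since the
  -- arguments only follow the walk step by step.
  data Near (u v : Vertex) : Set where
    near₀ : u ≡ v → Near u v
    near₁ : Adj u v → Near u v
    near₂ : ∀ x → Adj u x → Adj x v → Near u v
    near₃ : ∀ x y → Adj u x → Adj x y → Adj y v → Near u v

  near : HasDiameter G 3 → ∀ u v → Near u v
  near (within , _) u v with within u v
  ... | 0 , (nil , _) , _ = near₀ refl
  ... | 1 , (cons e nil , _) , _ = near₁ e
  ... | 2 , (cons e (cons e′ nil) , _) , _ = near₂ _ e e′
  ... | 3 , (cons e (cons e′ (cons e″ nil)) , _) , _ = near₃ _ _ e e′ e″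
  ... | suc (suc (suc (suc _))) , _ , s≤s (s≤s (s≤s ()))

  -- Two distinct edges u u′ and v v′ that may meet only in u′ ≡ v′.
  record TwoEdges : Set where
    field
      {u u′ v v′} : Vertex
      uu′  : Adj u u′
      vv′  : Adj v v′
      u≢v  : u ≢ v
      u≢v′ : u ≢ v′
      v≢u′ : v ≢ u′
      cover : ∀ {y z} → Adj y z →
        (y ≡ u × z ≡ u′) ⊎ (y ≡ u′ × z ≡ u) ⊎ (y ≡ v × z ≡ v′) ⊎ (y ≡ v′ × z ≡ v)

  -- Distinct edges of a simple graph share at most one endpoint, so each can be oriented to put a
  -- shared endpoint second.
  size≡2⇒TwoEdges : size ≡ 2 → TwoEdges
  size≡2⇒TwoEdges eq with edges in edges≡ | cartesianProduct⁺ (allFin⁺ order) (allFin⁺ order)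
  ... | (a , b) ∷ (c , d) ∷ [] | unique-pairs = choose (a ≟ c) (b ≟ d) (a ≟ d) (b ≟ c)
    where
    edge? : Decidable (λ ((u , v) : Vertex × Vertex) → u <ᶠ v × Adj u v)
    edge? (u , v) = (u <? v) ×-dec T? (adj u v)
    edge⁻ : ∀ {e} → e ∈ (a , b) ∷ (c , d) ∷ [] → proj₁ e <ᶠ proj₂ e × Adj (proj₁ e) (proj₂ e)
    edge⁻ e∈ = proj₂ (∈-filter⁻ edge? {xs = cartesianProduct (allFin order) (allFin order)}
                        (subst (_ ∈_) (sym edges≡) e∈))
    edge⁺ : ∀ {y z} → y <ᶠ z → Adj y z → (y , z) ∈ (a , b) ∷ (c , d) ∷ []
    edge⁺ {y} {z} y<z yz = subst (_ ∈_) edges≡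
      (∈-filter⁺ edge? (∈-cartesianProduct⁺ (∈-allFin y) (∈-allFin z)) (y<z , yz))
    ab≢cd : (a , b) ≢ (c , d)
    ab≢cd with subst Unique edges≡ (filter⁺ edge? unique-pairs)
    ... | (≢ ∷ []) ∷ _ = ≢
    ab : Adj a b
    ab = proj₂ (edge⁻ (here refl))
    cd : Adj c d
    cd = proj₂ (edge⁻ (there (here refl)))
    cover′ : ∀ {y z} → Adj y z →
      (y ≡ a × z ≡ b) ⊎ (y ≡ b × z ≡ a) ⊎ (y ≡ c × z ≡ d) ⊎ (y ≡ d × z ≡ c)
    cover′ {y} {z} yz with <-cmp y z
    ... | tri≈ _ y≡z _ = contradiction y≡z (Adj⇒≢ yz)
    ... | tri< y<z _ _ with edge⁺ y<z yz
    ...   | here refl         = inj₁ (refl , refl)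
    ...   | there (here refl) = inj₂ (inj₂ (inj₁ (refl , refl)))
    cover′ {y} {z} yz | tri> _ _ z<y with edge⁺ z<y (Adj-sym yz)
    ...   | here refl         = inj₂ (inj₁ (refl , refl))
    ...   | there (here refl) = inj₂ (inj₂ (inj₂ (refl , refl)))
    flip₁ : ∀ {A B C D : Set} → A ⊎ B ⊎ C ⊎ D → B ⊎ A ⊎ C ⊎ D
    flip₁ = [ inj₂ ∘ inj₁ , [ inj₁ , inj₂ ∘ inj₂ ]′ ]′
    flip₂ : ∀ {A B C D : Set} → A ⊎ B ⊎ C ⊎ D → A ⊎ B ⊎ D ⊎ C
    flip₂ = [ inj₁ , [ inj₂ ∘ inj₁ , inj₂ ∘ inj₂ ∘ swap-⊎ ]′ ]′
    choose : Dec (a ≡ c) → Dec (b ≡ d) → Dec (a ≡ d) → Dec (b ≡ c) → TwoEdges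
    choose (yes refl) (yes refl) _ _ = contradiction refl ab≢cd
    choose (yes refl) (no b≢d) _ _ = record
      { uu′ = Adj-sym ab ; vv′ = Adj-sym cd ; u≢v = b≢d ; u≢v′ = Adj⇒≢ (Adj-sym ab)
      ; v≢u′ = Adj⇒≢ (Adj-sym cd) ; cover = flip₂ ∘ flip₁ ∘ cover′ }
    choose (no a≢c) (yes refl) _ _ = record
      { uu′ = ab ; vv′ = cd ; u≢v = a≢c ; u≢v′ = Adj⇒≢ ab ; v≢u′ = Adj⇒≢ cd ; cover = cover′ }
    choose (no a≢c) (no b≢d) (yes refl) (no b≢c) = record
      { uu′ = Adj-sym ab ; vv′ = cd ; u≢v = b≢c ; u≢v′ = b≢d ; v≢u′ = Adj⇒≢ cd
      ; cover = flip₁ ∘ cover′ }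
    -- Both pairs list the smaller endpoint first, so they cannot be reverses of each other.
    choose (no a≢c) (no b≢d) (yes refl) (yes refl) =
      contradiction (proj₁ (edge⁻ (there (here refl)))) (<-asym (proj₁ (edge⁻ (here refl))))
    choose (no a≢c) (no b≢d) (no a≢d) (yes refl) = record
      { uu′ = ab ; vv′ = Adj-sym cd ; u≢v = a≢d ; u≢v′ = a≢c ; v≢u′ = b≢d ∘ sym
      ; cover = flip₂ ∘ cover′ }
    choose (no a≢c) (no b≢d) (no a≢d) (no b≢c) = record
      { uu′ = ab ; vv′ = cd ; u≢v = a≢c ; u≢v′ = a≢d ; v≢u′ = b≢c ∘ sym ; cover = cover′ }

-- Weights, isomorphisms and the labeling of `M₁₁⟨0,0⟩`.

module _ {c ℓ} (A : AbelianGroup c ℓ) where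
  open AbelianGroup A renaming (refl to ≈-refl; sym to ≈-sym; trans to ≈-trans)
  open AbelianGroupProperties A using (ε⁻¹≈ε; ⁻¹-injective)

  fold-↭ : ∀ {B : Set} (l : B → Carrier) {xs ys} → xs ↭ ys →
    foldr _∙_ ε (map l xs) ≈ foldr _∙_ ε (map l ys)
  fold-↭ l _↭_.refl       = ≈-refl
  fold-↭ l (prep x p)     = ∙-congˡ (fold-↭ l p)
  fold-↭ l (swap x y p)   = ≈-trans (≈-sym (assoc _ _ _)) (≈-trans (∙-congʳ (comm _ _))
                              (≈-trans (assoc _ _ _) (∙-congˡ (∙-congˡ (fold-↭ l p)))))
  fold-↭ l (_↭_.trans p q) = ≈-trans (fold-↭ l p) (fold-↭ l q)

  -- The labeling is pulled back along the isomorphism, which carries the neighbours of `v` to those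
  -- of `to v` in some order; `fold-↭` then equates the weights.
  VertexMagic-resp-≅ : ∀ G H → G ≅ H → VertexMagic A H → VertexMagic A G
  VertexMagic-resp-≅ G H (f , pres) (l , l≉ε , μ , w≈μ) =
    l ∘ to , l≉ε ∘ to , μ , λ v →
      ≈-trans (≈-trans (reflexive (cong (foldr _∙_ ε) (map-∘ (G.neighbours v)))) (fold-↭ l (image v))) (w≈μ (to v))
    where
    module G = GraphProperties G
    module H = GraphProperties H
    open Inverse f using (to; from; strictlyInverseˡ; strictlyInverseʳ)
    to-injective : ∀ {u v} → to u ≡ to v → u ≡ v
    to-injective {u} {v} eq = trans (sym (strictlyInverseʳ u)) (trans (cong from eq) (strictlyInverseʳ v))
    image : ∀ v → map to (G.neighbours v) ↭ H.neighbours (to v)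
    image v = unique∧set⇒↭ (Unique-map⁺ to-injective (G.neighbours-unique v)) (H.neighbours-unique (to v))
      (λ z∈ → case ∈-map⁻ to z∈ of λ { (u , u∈ , refl) →
         H.∈-neighbours⁺ (subst T (pres v u) (G.∈-neighbours⁻ u∈)) })
      (λ {z} z∈ → subst (_∈ map to (G.neighbours v)) (strictlyInverseˡ z)
         (∈-map⁺ to (G.∈-neighbours⁺ (subst T
           (trans (cong (H.adj (to v)) (sym (strictlyInverseˡ z))) (sym (pres v (from z))))
           (H.∈-neighbours⁻ z∈)))))

  VertexMagic-M₁₁ : Nontrivial A → VertexMagic A M₁₁⟨0,0⟩
  VertexMagic-M₁₁ (a , a≉ε) = l , l≉ε , ε , weights
    where
    l : Fin 7 → Carrier
    l 0F = a
    l 1F = a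
    l 2F = a ⁻¹
    l 3F = a ⁻¹
    l 4F = a
    l 5F = a ⁻¹
    l 6F = a ⁻¹
    a⁻¹≉ε : ¬ (a ⁻¹ ≈ ε)
    a⁻¹≉ε eq = a≉ε (⁻¹-injective (≈-trans eq (≈-sym ε⁻¹≈ε)))
    l≉ε : ∀ v → ¬ (l v ≈ ε)
    l≉ε 0F = a≉ε
    l≉ε 1F = a≉ε
    l≉ε 2F = a⁻¹≉ε
    l≉ε 3F = a⁻¹≉ε
    l≉ε 4F = a≉ε
    l≉ε 5F = a⁻¹≉ε
    l≉ε 6F = a⁻¹≉ε
    a∙a⁻¹ : a ∙ (a ⁻¹ ∙ ε) ≈ ε
    a∙a⁻¹ = ≈-trans (∙-congˡ (identityʳ _)) (inverseʳ a)
    a⁻¹∙a : a ⁻¹ ∙ (a ∙ ε) ≈ ε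
    a⁻¹∙a = ≈-trans (∙-congˡ (identityʳ _)) (inverseˡ a)
    -- The shared vertex has neighbours 1, 4, 5, 6 in this order, two labelled `a` and two `a ⁻¹`;
    -- the inner pair cancels first.
    hub : a ∙ (a ∙ (a ⁻¹ ∙ (a ⁻¹ ∙ ε))) ≈ ε
    hub = ≈-trans (∙-congˡ (≈-trans (≈-sym (assoc _ _ _))
            (≈-trans (∙-congʳ (inverseʳ a)) (identityˡ _)))) a∙a⁻¹
    weights : ∀ v → weight A M₁₁⟨0,0⟩ l v ≈ ε
    weights 0F = hub
    weights 1F = a∙a⁻¹
    weights 2F = a∙a⁻¹
    weights 3F = a⁻¹∙a
    weights 4F = a∙a⁻¹
    weights 5F = a∙a⁻¹
    weights 6F = a∙a⁻¹

-- Universe levels, and labelings over ℤ/2.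

liftGroup : ∀ c ℓ → AbelianGroup 0ℓ 0ℓ → AbelianGroup c ℓ
liftGroup c ℓ A = record
  { Carrier = Lift c Carrier
  ; _≈_ = λ x y → Lift ℓ (lower x ≈ lower y)
  ; _∙_ = λ x y → lift (lower x ∙ lower y)
  ; ε = lift ε
  ; _⁻¹ = λ x → lift (lower x ⁻¹)
  ; isAbelianGroup = record
    { isGroup = record
      { isMonoid = record
        { isSemigroup = record
          { isMagma = record
            { isEquivalence = record
              { refl = lift A.refl
              ; sym = lift ∘ A.sym ∘ lower
              ; trans = λ p q → lift (A.trans (lower p) (lower q)) }
            ; ∙-cong = λ p q → lift (∙-cong (lower p) (lower q)) }
          ; assoc = λ _ _ _ → lift (assoc _ _ _) }
        ; identity = (λ _ → lift (identityˡ _)) , (λ _ → lift (identityʳ _)) }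
      ; inverse = (λ _ → lift (inverseˡ _)) , (λ _ → lift (inverseʳ _))
      ; ⁻¹-cong = lift ∘ ⁻¹-cong ∘ lower }
    ; comm = λ _ _ → lift (comm _ _) } }
  where
  module A = AbelianGroup A
  open A hiding (refl; sym; trans)

-- The hypothesis concerns groups at levels `c` and `ℓ`, while ℤ/2 and ℤ live at level 0; a labeling
-- over the lifted group is lowered entrywise.
GroupVertexMagic⇒VertexMagic : ∀ {c ℓ} {G} → GroupVertexMagic c ℓ G →
  (A : AbelianGroup 0ℓ 0ℓ) → Nontrivial A → VertexMagic A G
GroupVertexMagic⇒VertexMagic {c} {ℓ} {G} gvm A (a , a≉ε) =
  let l , l≉ε , μ , w≈μ = gvm (liftGroup c ℓ A) (lift a , a≉ε ∘ lower)
  in lower ∘ l , (λ v → l≉ε v ∘ lift) , lower μ ,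
     λ v → A.trans (A.reflexive (lower-fold l (Graph.neighbours G v))) (lower (w≈μ v))
  where
  module A = AbelianGroup A
  lower-fold : ∀ {B : Set} (l : B → Lift c A.Carrier) xs →
    foldr A._∙_ A.ε (map (lower ∘ l) xs) ≡
    lower (foldr (AbelianGroup._∙_ (liftGroup c ℓ A)) (AbelianGroup.ε (liftGroup c ℓ A)) (map l xs))
  lower-fold l []       = refl
  lower-fold l (x ∷ xs) = cong (lower (l x) A.∙_) (lower-fold l xs)

odd : ℕ → Bool
odd zero    = false
odd (suc n) = not (odd n)

ℤ/2 : AbelianGroup 0ℓ 0ℓ
ℤ/2 = CommutativeRing.+-abelianGroup xor-∧-commutativeRing

sameParity : ∀ {G} → VertexMagic ℤ/2 G →
  ∃[ b ] ∀ v → odd (length (Graph.neighbours G v)) ≡ b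
sameParity {G} (l , l≢0 , μ , w≡μ) = μ , λ v → trans (sym (fold≡odd (Graph.neighbours G v))) (w≡μ v)
  where
  fold≡odd : ∀ vs → foldr _xor_ false (map l vs) ≡ odd (length vs)
  fold≡odd []       = refl
  fold≡odd (v ∷ vs) rewrite ¬-not (l≢0 v) = cong not (fold≡odd vs)

-- All degrees odd.

module OddDegrees (G : Graph) (size≡ : Graph.size G ≡ suc (Graph.order G))
                  (v₀ : Graph.Vertex G) (nearby : ∀ u v → GraphProperties.Near G u v)
                  (odd-degree : ∀ v → odd (GraphProperties.degree G v) ≡ true) where
  open GraphProperties G

  -- Without leaves every degree is at least 3, so 3n ≤ 2n + 2 for the order n, that is n ≤ 2; but
  -- the degree of `v₀` is at most n.
  ∃leaf : ∃[ y ] degree y ≡ 1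
  ∃leaf with any? (λ y → degree y ≟ⁿ 1)
  ... | yes leaf = leaf
  ... | no ¬leaf = contradiction (≤-trans (3≤degree v₀) (degree≤order v₀)) (<⇒≱ (s≤s order≤2))
    where
    3≤degree : ∀ v → 3 ≤ degree v
    3≤degree v with degree v | odd-degree v | (λ eq → ¬leaf (v , eq))
    ... | 1                   | _ | ≢1 = contradiction refl ≢1
    ... | suc (suc (suc _))   | _ | _  = s≤s (s≤s (s≤s z≤n))
    order≤2 : order ≤ 2
    order≤2 = +-cancelʳ-≤ (order + order) order 2 (begin
      order + (order + order)  ≡⟨ solve 1 (λ n → n :+ (n :+ n) := n :* con 3) refl order ⟩
      order * 3                ≡⟨ sum-const order 3 ⟨
      ∑[ v < order ] 3         ≤⟨ sum-mono 3≤degree ⟩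
      ∑[ v < order ] degree v  ≡⟨ handshake ⟩
      size + size              ≡⟨ cong₂ _+_ size≡ size≡ ⟩
      suc order + suc order    ≡⟨ cong suc (+-suc order order) ⟩
      2 + (order + order)      ∎)
      where
      open ≤-Reasoning
      open +-*-Solver

  -- Every vertex is within distance 2 of the support x of a leaf, which gives a spanning
  -- tree of depth 2; parent sends the root x to itself.
  module Rooted (x : Vertex) (radius : ∀ v → v ≡ x ⊎ Adj v x ⊎ ∃[ u ] Adj v u × Adj u x) where

    -- Adjacency to `x` is tested before `radius` is consulted, since `radius` may return a detour
    -- of length 2 even for a neighbour of `x`. The decisions are arguments so that later proofs can
    -- split on them.
    choose-parent : ∀ v → Dec (v ≡ x) → Dec (Adj v x) → Vertex
    choose-parent v (yes _) _       = x
    choose-parent v (no _)  (yes _) = x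
    choose-parent v (no v≢x) (no v≁x) with radius v
    ... | inj₁ v≡x             = x
    ... | inj₂ (inj₁ vx)       = x
    ... | inj₂ (inj₂ (u , _))  = u

    parent : Vertex → Vertex
    parent v = choose-parent v (v ≟ x) (T? (adj v x))

    parent-root : parent x ≡ x
    parent-root with x ≟ x
    ... | yes _   = refl
    ... | no x≢x = contradiction refl x≢x

    parent-adj : ∀ {v} → v ≢ x → Adj v (parent v)
    parent-adj {v} v≢x = go (v ≟ x) (T? (adj v x))
      where
      go : ∀ d e → Adj v (choose-parent v d e)
      go (yes v≡x) _       = contradiction v≡x v≢x
      go (no _)    (yes vx) = vx
      go (no _) (no v≁x) with radius v
      ... | inj₁ v≡x                 = contradiction v≡x v≢x
      ... | inj₂ (inj₁ vx)           = vx
      ... | inj₂ (inj₂ (_ , vu , _)) = vu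

    parent-level₁ : ∀ {v} → Adj v x → parent v ≡ x
    parent-level₁ {v} vx = go (v ≟ x) (T? (adj v x))
      where
      go : ∀ d e → choose-parent v d e ≡ x
      go (yes _) _       = refl
      go (no _)  (yes _) = refl
      go (no _)  (no v≁x) = contradiction vx v≁x

    -- A parent is `x` or a neighbour of `x`, and `parent` sends both to `x`.
    parent² : ∀ v → parent (parent v) ≡ x
    parent² v = [ (λ eq → trans (cong parent eq) parent-root) , parent-level₁ ]′ (go (v ≟ x) (T? (adj v x)))
      where
      go : ∀ d e → choose-parent v d e ≡ x ⊎ Adj (choose-parent v d e) x
      go (yes _) _       = inj₁ refl
      go (no _)  (yes _) = inj₁ refl
      go (no _) (no _) with radius v
      ... | inj₁ _                   = inj₁ refl
      ... | inj₂ (inj₁ _)            = inj₁ refl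
      ... | inj₂ (inj₂ (_ , _ , ux)) = inj₂ ux

    -- The edges outside the spanning tree, taken as a graph so that degrees and `handshake` apply
    -- to it.
    Extra : Graph
    Extra = record
      { order      = order
      ; adj        = λ u v → adj u v ∧ (not (does (parent u ≟ v)) ∧ not (does (parent v ≟ u)))
      ; adj-sym    = λ u v → cong₂ _∧_ (adj-sym u v) (∧-comm (not (does (parent u ≟ v))) _)
      ; adj-irrefl = λ v → cong (_∧ (not (does (parent v ≟ v)) ∧ not (does (parent v ≟ v)))) (adj-irrefl v)
      }
    module X = GraphProperties Extra

    Extra⁺ : ∀ {u v} → Adj u v → parent u ≢ v → parent v ≢ u → X.Adj u v
    Extra⁺ {u} {v} uv pu≢v pv≢u with parent u ≟ v | parent v ≟ u
    ... | yes eq | _      = contradiction eq pu≢v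
    ... | no _   | yes eq = contradiction eq pv≢u
    ... | no _   | no _   = Equivalence.from T-∧ (uv , tt)

    Extra⇒≢parent : ∀ {u v} → X.Adj u v → parent u ≢ v
    Extra⇒≢parent {u} {v} uv pu≡v with parent u ≟ v | Equivalence.to (T-∧ {adj u v}) uv
    ... | no ≢ | _ = ≢ pu≡v

    children : Vertex → ℕ
    children u = ∑[ v < order ] ind (does (parent v ≟ u))

    -- An edge is either extra or joins a vertex to its parent in exactly one direction. The root,
    -- being its own parent, is counted in both directions on the right; `r + r` pays for this.
    adj-split : ∀ u v → let r = ind (does (x ≟ u) ∧ does (x ≟ v)) in
      ind (adj u v) + (r + r) ≡
      ind (X.adj u v) + (ind (does (parent u ≟ v)) + ind (does (parent v ≟ u)))
    adj-split u v = go (parent u ≟ v) (parent v ≟ u) (x ≟ u) (x ≟ v)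
      where
      present : ∀ {b} → T b → ind b + 0 ≡ ind (b ∧ false) + 1
      present {true} _ = refl
      go : (d : Dec (parent u ≡ v)) (d′ : Dec (parent v ≡ u)) (e : Dec (x ≡ u)) (e′ : Dec (x ≡ v)) →
        let r = ind (does e ∧ does e′) in
        ind (adj u v) + (r + r) ≡
        ind (adj u v ∧ (not (does d) ∧ not (does d′))) + (ind (does d) + ind (does d′))
      go (yes _) (yes _) (yes x≡u) (yes x≡v) =
        subst (λ b → ind b + 2 ≡ ind (b ∧ false) + 2)
          (sym (trans (cong₂ adj (sym x≡u) (sym x≡v)) (adj-irrefl x))) refl
      -- Going up twice from `u` returns to `u`, but by `parent²` it also reaches the root.
      go (yes pu≡v) (yes pv≡u) (no x≢u) _ =
        contradiction (trans (sym (parent² u)) (trans (cong parent pu≡v) pv≡u)) x≢u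
      go (yes pu≡v) (yes pv≡u) _ (no x≢v) =
        contradiction (trans (sym (parent² v)) (trans (cong parent pv≡u) pu≡v)) x≢v
      go (yes pu≡v) (no pv≢u) (yes x≡u) _ =
        contradiction (trans (cong parent (sym pu≡v)) (trans (parent² u) x≡u)) pv≢u
      go (yes pu≡v) (no _) (no x≢u) _ = present (subst (Adj u) pu≡v (parent-adj (x≢u ∘ sym)))
      go (no pu≢v) (yes pv≡u) _ (yes x≡v) =
        contradiction (trans (cong parent (sym pv≡u)) (trans (parent² v) x≡v)) pu≢v
      go (no _) (yes pv≡u) (yes _) (no x≢v) = present (Adj-sym (subst (Adj v) pv≡u (parent-adj (x≢v ∘ sym))))
      go (no _) (yes pv≡u) (no _) (no x≢v) = present (Adj-sym (subst (Adj v) pv≡u (parent-adj (x≢v ∘ sym))))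
      go (no pu≢v) (no _) (yes x≡u) (yes x≡v) =
        contradiction (trans (cong parent (sym x≡u)) (trans parent-root x≡v)) pu≢v
      go (no _) (no _) (yes _) (no _) = cong (λ b → ind b + 0) (sym (∧-identityʳ _))
      go (no _) (no _) (no _) _ = cong (λ b → ind b + 0) (sym (∧-identityʳ _))

    root-sum : ∀ u → ∑[ v < order ] ind (does (x ≟ u) ∧ does (x ≟ v)) ≡ ind (does (x ≟ u))
    root-sum u with x ≟ u
    ... | yes _ = sum-ind-≟ x
    ... | no _  = sum-replicate-zero order

    -- This is `adj-split` summed over `v`: the neighbours of `u` are its extra neighbours, its
    -- parent and its children. Two units correct for the root being its own parent and child.
    degree-split : ∀ u → degree u + (ind (does (x ≟ u)) + ind (does (x ≟ u))) ≡ X.degree u + (1 + children u)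
    degree-split u = begin
      degree u + (ind (does (x ≟ u)) + ind (does (x ≟ u)))
        ≡⟨ cong₂ _+_ (degree-sum u) (sym (cong₂ _+_ (root-sum u) (root-sum u))) ⟩
      sum (λ v → ind (adj u v)) + (sum r + sum r)
        ≡⟨ cong (sum (λ v → ind (adj u v)) +_) (∑-distrib-+ r r) ⟨
      sum (λ v → ind (adj u v)) + sum (λ v → r v + r v)
        ≡⟨ ∑-distrib-+ (λ v → ind (adj u v)) (λ v → r v + r v) ⟨
      sum (λ v → ind (adj u v) + (r v + r v))
        ≡⟨ sum-cong-≗ (adj-split u) ⟩
      sum (λ v → ind (X.adj u v) + (ind (does (parent u ≟ v)) + ind (does (parent v ≟ u))))
        ≡⟨ ∑-distrib-+ (λ v → ind (X.adj u v)) _ ⟩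
      sum (λ v → ind (X.adj u v)) + sum (λ v → ind (does (parent u ≟ v)) + ind (does (parent v ≟ u)))
        ≡⟨ cong₂ _+_ (sym (X.degree-sum u)) (∑-distrib-+ (λ v → ind (does (parent u ≟ v))) _) ⟩
      X.degree u + (sum (λ v → ind (does (parent u ≟ v))) + children u)
        ≡⟨ cong (λ k → X.degree u + (k + children u)) (sum-ind-≟ (parent u)) ⟩
      X.degree u + (1 + children u) ∎
      where
      open ≡-Reasoning
      r : Vertex → ℕ
      r v = ind (does (x ≟ u) ∧ does (x ≟ v))

    degree-nonroot : ∀ {u} → u ≢ x → degree u ≡ X.degree u + (1 + children u)
    degree-nonroot {u} u≢x with x ≟ u | degree-split u
    ... | yes x≡u | _  = contradiction (sym x≡u) u≢x
    ... | no _    | eq = trans (sym (+-identityʳ _)) eq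

    sum-children : ∑[ u < order ] children u ≡ order
    sum-children = trans (∑-comm (λ u v → ind (does (parent v ≟ u))))
      (trans (sum-cong-≗ (λ v → sum-ind-≟ (parent v))) (trans (sum-const order 1) (*-identityʳ order)))

    -- With n the order and m the number of extra edges, summing `degree-split` over all vertices
    -- gives 2(n + 1) + 2 = 2m + 2n.
    Extra-size : X.size ≡ 2
    Extra-size = halve (+-cancelʳ-≡ (order + order) (X.size + X.size) 4 (begin
      (X.size + X.size) + (order + order)
        ≡⟨ cong₂ _+_ X.handshake (cong₂ _+_ (trans (sum-const order 1) (*-identityʳ order)) sum-children) ⟨
      sum X.degree + (sum (λ (_ : Vertex) → 1) + sum children)
        ≡⟨ cong (sum X.degree +_) (∑-distrib-+ (λ _ → 1) children) ⟨
      sum X.degree + sum (λ u → 1 + children u)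
        ≡⟨ ∑-distrib-+ X.degree _ ⟨
      sum (λ u → X.degree u + (1 + children u))
        ≡⟨ sum-cong-≗ degree-split ⟨
      sum (λ u → degree u + (root u + root u))
        ≡⟨ ∑-distrib-+ degree _ ⟩
      sum degree + sum (λ u → root u + root u)
        ≡⟨ cong₂ _+_ (trans handshake (cong₂ _+_ size≡ size≡))
             (trans (∑-distrib-+ root root) (cong₂ _+_ (sum-ind-≟ x) (sum-ind-≟ x))) ⟩
      (suc order + suc order) + 2
        ≡⟨ solve 1 (λ n → (con 1 :+ n :+ (con 1 :+ n)) :+ con 2 := con 4 :+ (n :+ n)) refl order ⟩
      4 + (order + order) ∎))
      where
      open ≡-Reasoning
      open +-*-Solver
      root : Vertex → ℕ
      root u = ind (does (x ≟ u))
      halve : ∀ {m} → m + m ≡ 4 → m ≡ 2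
      halve {2} _ = refl
      halve {suc (suc (suc m))} eq
        rewrite +-suc m (suc (suc m)) | +-suc m (suc m) = contradiction eq λ ()

    -- Every edge at the root is a tree edge, because all neighbours of `x` have parent `x`.
    Extra⇒≢root : ∀ {u v} → X.Adj u v → u ≢ x
    Extra⇒≢root {u} {v} uv refl = Extra⇒≢parent {v} {u} (X.Adj-sym {u} {v} uv)
      (parent-level₁ (Adj-sym (proj₁ (Equivalence.to (T-∧ {adj u v}) uv))))

    -- With one extra edge and one parent, a childless `u` would have even degree 2.
    ∃child : ∀ {u} → u ≢ x → X.degree u ≡ 1 → ∃[ c ] parent c ≡ u
    ∃child {u} u≢x deg≡1 = let c , ≢0 = sum≢0⇒∃≢0 _ children≢0 in c , from-ind (parent c ≟ u) ≢0
      where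
      children≢0 : children u ≢ 0
      children≢0 eq = contradiction (trans (sym (odd-degree u))
        (cong odd (trans (degree-nonroot u≢x) (cong₂ (λ d k → d + (1 + k)) deg≡1 eq)))) λ ()
      from-ind : ∀ {P : Set} (d : Dec P) → ind (does d) ≢ 0 → P
      from-ind (yes p) _  = p
      from-ind (no _)  ≢0 = contradiction refl ≢0

    children≡0 : ∀ {c} → parent c ≢ x → children c ≡ 0
    children≡0 {c} pc≢x = trans (sum-cong-≗ (λ v → absent (parent v ≟ c) λ pv≡c →
      pc≢x (trans (cong parent (sym pv≡c)) (parent² v)))) (sum-replicate-zero order)
      where
      absent : ∀ {P : Set} (d : Dec P) → ¬ P → ind (does d) ≡ 0
      absent (yes p) ¬p = contradiction p ¬p
      absent (no _)  _  = refl

    -- A vertex whose parent is not the root lies at depth 2 and has no children, so a single extra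
    -- edge would give it degree 2.
    grandchild-Extra-degree≢1 : ∀ {c} → parent c ≢ x → X.degree c ≢ 1
    grandchild-Extra-degree≢1 {c} pc≢x deg≡1 = contradiction (trans (sym (odd-degree c))
      (cong odd (trans (degree-nonroot c≢x) (cong₂ (λ d k → d + (1 + k)) deg≡1 (children≡0 pc≢x))))) λ ()
      where
      c≢x : c ≢ x
      c≢x refl = pc≢x parent-root

    module _ (two : X.TwoEdges) where
      open X.TwoEdges two

      u≢x : u ≢ x
      u≢x = Extra⇒≢root uu′

      -- By parity an endpoint of exactly one extra edge has a child, and this child is a leaf
      -- of G: it cannot lie on exactly one extra edge, and the edge at u joins it to u already.
      ∃leaf-child : ∃[ c ] parent c ≡ u × (∀ {z} → Adj c z → z ≡ u)
      ∃leaf-child with ∃child u≢x (X.degree≡1 uu′ λ uz → case cover uz of λ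
        { (inj₁ (_ , eq))                 → eq
        ; (inj₂ (inj₁ (eq , _)))          → contradiction eq (X.Adj⇒≢ uu′)
        ; (inj₂ (inj₂ (inj₁ (eq , _))))   → contradiction eq u≢v
        ; (inj₂ (inj₂ (inj₂ (eq , _))))   → contradiction eq u≢v′ })
      ... | c , pc≡u = c , pc≡u , only-parent
        where
        pc≢x : parent c ≢ x
        pc≢x eq = u≢x (trans (sym pc≡u) eq)
        c≢x : c ≢ x
        c≢x refl = pc≢x parent-root
        ¬Extra-u : ∀ {z} → X.Adj c z → z ≢ u
        ¬Extra-u {z} cz z≡u = Extra⇒≢parent {c} {z} cz (trans pc≡u (sym z≡u))
        degree≢1 : ∀ {z} → X.Adj c z → ¬ (∀ {z′} → X.Adj c z′ → z′ ≡ z)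
        degree≢1 cz only = grandchild-Extra-degree≢1 pc≢x (X.degree≡1 cz only)
        ¬Extra : ∀ {z} → ¬ X.Adj c z
        ¬Extra {z} cz with cover cz
        ... | inj₁ (c≡u , _) = Adj⇒≢ (parent-adj c≢x) (trans c≡u (sym pc≡u))
        ... | inj₂ (inj₁ (_ , z≡u)) = ¬Extra-u cz z≡u
        ... | inj₂ (inj₂ (inj₁ (c≡v , z≡v′))) = degree≢1 cz λ cz′ → case cover cz′ of λ
          { (inj₁ (c≡u , _))                  → contradiction (trans (sym c≡u) c≡v) u≢v
          ; (inj₂ (inj₁ (c≡u′ , _)))          → contradiction (trans (sym c≡v) c≡u′) v≢u′
          ; (inj₂ (inj₂ (inj₁ (_ , z′≡v′))))  → trans z′≡v′ (sym z≡v′)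
          ; (inj₂ (inj₂ (inj₂ (c≡v′ , _))))   → contradiction (trans (sym c≡v) c≡v′) (X.Adj⇒≢ vv′) }
        ... | inj₂ (inj₂ (inj₂ (c≡v′ , z≡v))) = degree≢1 cz λ cz′ → case cover cz′ of λ
          { (inj₁ (c≡u , _))                  → contradiction (trans (sym c≡u) c≡v′) u≢v′
          ; (inj₂ (inj₁ (_ , z′≡u)))          → contradiction z′≡u (¬Extra-u cz′)
          ; (inj₂ (inj₂ (inj₁ (c≡v , _))))    → contradiction (trans (sym c≡v) c≡v′) (X.Adj⇒≢ vv′)
          ; (inj₂ (inj₂ (inj₂ (_ , z′≡v))))   → trans z′≡v (sym z≡v) }
        only-parent : ∀ {z} → Adj c z → z ≡ u
        only-parent {z} cz with parent c ≟ z
        ... | yes pc≡z = trans (sym pc≡z) pc≡u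
        ... | no pc≢z  = contradiction
          (Extra⁺ cz pc≢z λ pz≡c → pc≢x (trans (cong parent (sym pz≡c)) (parent² z))) ¬Extra

    flip : X.TwoEdges → X.TwoEdges
    flip two = record
      { uu′ = vv′ ; vv′ = uu′ ; u≢v = u≢v ∘ sym ; u≢v′ = v≢u′ ; v≢u′ = u≢v′
      ; cover = [ inj₂ ∘ inj₂ ∘ inj₁ , [ inj₂ ∘ inj₂ ∘ inj₂ , [ inj₁ , inj₂ ∘ inj₁ ]′ ]′ ]′ ∘ cover }
      where open X.TwoEdges two

    absurd : ⊥
    absurd with X.size≡2⇒TwoEdges Extra-size
    ... | two with ∃leaf-child two | ∃leaf-child (flip two)
    ...   | c , pc≡u , only-u | c′ , pc′≡v , only-v = go (nearby c c′)
      where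
      open X.TwoEdges two
      pu≡x : parent u ≡ x
      pu≡x = trans (cong parent (sym pc≡u)) (parent² c)
      pv≡x : parent v ≡ x
      pv≡x = trans (cong parent (sym pc′≡v)) (parent² c′)
      go : ¬ Near c c′
      go (near₀ refl) = u≢v (trans (sym pc≡u) pc′≡v)
      -- Here `c′` is `u`, so `v`, the parent of `c′`, would be the root.
      go (near₁ cc′) = u≢x (flip two) (trans (sym pc′≡v) (trans (cong parent (only-u cc′)) pu≡x))
      go (near₂ y cy yc′) = u≢v (trans (sym (only-u cy)) (only-v (Adj-sym yc′)))
      -- The walk must run through `u` and `v`. Both are children of the root, so neither is the
      -- parent of the other and the edge `uv` is extra; but `cover` does not list it.
      go (near₃ y z cy yz zc′) = case cover (Extra⁺ uv (λ eq → u≢x (flip two) (trans (sym eq) pu≡x))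
                                                       (λ eq → u≢x two (trans (sym eq) pv≡x))) of λ
          { (inj₁ (_ , eq))                 → v≢u′ eq
          ; (inj₂ (inj₁ (eq , _)))          → X.Adj⇒≢ uu′ eq
          ; (inj₂ (inj₂ (inj₁ (eq , _))))   → u≢v eq
          ; (inj₂ (inj₂ (inj₂ (eq , _))))   → u≢v′ eq }
        where
        uv : Adj u v
        uv = subst₂ Adj (only-u cy) (only-v (Adj-sym zc′)) yz

  contradictory : ⊥
  contradictory with ∃leaf
  ... | y , deg≡1 with degree≡1⇒∃! deg≡1
  -- Every walk leaving the leaf `y` starts through `x`, so what lies within distance 3 of `y` lies
  -- within distance 2 of `x`.
  ...   | x , yx , only-x = Rooted.absurd x λ v → case nearby y v of λ
    { (near₀ refl)             → inj₂ (inj₁ yx)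
    ; (near₁ yv)               → inj₁ (only-x yv)
    ; (near₂ z yz zv)          → inj₂ (inj₁ (Adj-sym (subst (λ t → Adj t v) (only-x yz) zv)))
    ; (near₃ z t yz zt tv)     → inj₂ (inj₂ (t , Adj-sym tv , Adj-sym (subst (λ s → Adj s t) (only-x yz) zt))) }

-- Auxiliary facts on lists, even numbers and the edges of `M₁₁⟨0,0⟩`.

∈⇒↭ : ∀ {A : Set} {x : A} {xs} → x ∈ xs → ∃[ ys ] xs ↭ x ∷ ys
∈⇒↭ {x = x} x∈xs with ∈-∃++ x∈xs
... | ys , zs , refl = ys ++ zs , shift x ys zs

lookup-injective : ∀ {A : Set} {xs : List A} → Unique xs → ∀ i j → lookup xs i ≡ lookup xs j → i ≡ j
lookup-injective (_ ∷ _)    zero    zero    _  = refl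
lookup-injective (x≢ ∷ _)   zero    (suc j) eq = contradiction eq (All.lookup x≢ (∈-lookup j))
lookup-injective (x≢ ∷ _)   (suc i) zero    eq = contradiction (sym eq) (All.lookup x≢ (∈-lookup i))
lookup-injective (_ ∷ xs!)  (suc i) (suc j) eq = cong suc (lookup-injective xs! i j eq)

even-positive : ∀ d → odd d ≡ false → d ≢ 0 → ∃[ e ] d ≡ 2 + (e + e)
even-positive zero                        _  ≢0 = contradiction refl ≢0
even-positive (suc (suc zero))            _  _  = 0 , refl
even-positive (suc (suc (suc (suc d)))) ev _
  with even-positive (suc (suc d)) (trans (sym (not-involutive _)) ev) (λ ())
... | e , eq = suc e , cong (2 +_) (trans eq (cong suc (sym (+-suc e e))))

length≡4 : ∀ {A : Set} (xs : List A) → length xs ≡ 4 →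
  ∃[ a ] ∃[ b ] ∃[ c ] ∃[ d ] xs ≡ a ∷ b ∷ c ∷ d ∷ []
length≡4 (a ∷ b ∷ c ∷ d ∷ []) _ = a , b , c , d , refl

M₁₁-adj⇒∈ : ∀ i j → T (M₁₁-adj i j) → (i , j) ∈ M₁₁-edges ⊎ (j , i) ∈ M₁₁-edges
M₁₁-adj⇒∈ i j e = split ((i , j) ∈? M₁₁-edges) ((j , i) ∈? M₁₁-edges) e
  where
  open DecMembership (≡-dec (_≟_ {7}) (_≟_ {7})) using (_∈?_)
  split : ∀ {P Q : Set} (p? : Dec P) (q? : Dec Q) → T (does p? ∨ does q?) → P ⊎ Q
  split (yes p) _       _ = inj₁ p
  split (no _)  (yes q) _ = inj₂ q

-- All degrees even.

module EvenDegrees (G : Graph) (bicyclic : Bicyclic G) (diam : HasDiameter G 3)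
                   (even-degree : ∀ v → odd (GraphProperties.degree G v) ≡ false)
                   (ℤ-magic : VertexMagic ℤ.+-0-abelianGroup G) where
  open GraphProperties G

  connected : Connected
  connected = proj₁ bicyclic

  nearby : ∀ u v → Near u v
  nearby = near diam

  -- An isolated vertex is near only itself, so it would be both ends of a pair at distance 3.
  degree≢0 : ∀ v → degree v ≢ 0
  degree≢0 v deg≡0 with proj₂ diam
  ... | s , t , _ , shortest = contradiction (shortest 0 (subst (λ z → Walk z t 0) (trans (sym v≡t) v≡s) nil)) λ ()
    where
    isolated : ∀ {z} → Near v z → v ≡ z
    isolated (near₀ eq)          = eq
    isolated (near₁ e)           = contradiction e (degree≡0⇒¬Adj deg≡0)
    isolated (near₂ _ e _)       = contradiction e (degree≡0⇒¬Adj deg≡0)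
    isolated (near₃ _ _ e _ _)   = contradiction e (degree≡0⇒¬Adj deg≡0)
    v≡s = isolated (nearby v s)
    v≡t = isolated (nearby v t)

  -- Write each degree as `2 + (e + e)`. The degree sum 2n + 2 leaves a total of 1 for the values
  -- `e`, so exactly one of them is 1 and the others vanish.
  ∃hub : ∃[ w ] degree w ≡ 4 × (∀ v → v ≢ w → degree v ≡ 2)
  ∃hub =
    let w , excess≡1 , rest = sum≡1⇒∃!1 excess sum-excess
    in w , trans (excess-spec w) (cong (λ e → 2 + (e + e)) excess≡1) ,
       λ v v≢w → trans (excess-spec v) (cong (λ e → 2 + (e + e)) (rest v v≢w))
    where
    excess : Vertex → ℕ
    excess v = proj₁ (even-positive (degree v) (even-degree v) (degree≢0 v))
    excess-spec : ∀ v → degree v ≡ 2 + (excess v + excess v)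
    excess-spec v = proj₂ (even-positive (degree v) (even-degree v) (degree≢0 v))
    halve : ∀ {m} → m + m ≡ 2 → m ≡ 1
    halve {1} _ = refl
    halve {suc (suc m)} eq rewrite +-suc m (suc m) = contradiction eq λ ()
    sum-excess : sum excess ≡ 1
    sum-excess = halve (+-cancelˡ-≡ (order * 2) _ _ (begin
      order * 2 + (sum excess + sum excess)
        ≡⟨ cong₂ _+_ (sum-const order 2) (∑-distrib-+ excess excess) ⟨
      sum (λ (_ : Vertex) → 2) + sum (λ v → excess v + excess v)
        ≡⟨ ∑-distrib-+ (λ _ → 2) (λ v → excess v + excess v) ⟨
      sum (λ v → 2 + (excess v + excess v))
        ≡⟨ sum-cong-≗ excess-spec ⟨
      sum degree
        ≡⟨ trans handshake (cong₂ _+_ (proj₂ bicyclic) (proj₂ bicyclic)) ⟩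
      suc order + suc order
        ≡⟨ solve 1 (λ n → con 1 :+ n :+ (con 1 :+ n) := n :* con 2 :+ con 2) refl order ⟩
      order * 2 + 2 ∎))
      where
      open ≡-Reasoning
      open +-*-Solver

  ∈⁻ : ∀ {v z xs} → neighbours v ↭ xs → Adj v z → z ∈ xs
  ∈⁻ N vz = ∈-resp-↭ N (∈-neighbours⁺ vz)

  ∈⁺ : ∀ {v z xs} → neighbours v ↭ xs → z ∈ xs → Adj v z
  ∈⁺ N z∈ = ∈-neighbours⁻ (∈-resp-↭ (↭-sym N) z∈)

  -- Connectedness as an induction principle: a nonempty set of vertices closed under adjacency is
  -- everything.
  closed⇒all : (P : Vertex → Set) → (∀ {u v} → P u → Adj u v → P v) → ∀ {u} → P u → ∀ v → P v
  closed⇒all P step {u} pu v = go pu (proj₂ (connected u v))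
    where
    go : ∀ {u k} → P u → Walk u v k → P v
    go pu nil        = pu
    go pu (cons e p) = go (step pu e) p

  -- The vertex of degree 4 and its neighbours.

  module Hub (w : Vertex) (degree-w : degree w ≡ 4) (degree-rest : ∀ v → v ≢ w → degree v ≡ 2) where

    other : ∀ {v u} → v ≢ w → Adj v u → ∃[ u′ ] neighbours v ↭ u ∷ u′ ∷ []
    other {v} v≢w vu with ∈⇒↭ (∈-neighbours⁺ vu)
    ... | ys , N with ys | N | trans (sym (↭-length N)) (degree-rest v v≢w)
    ...   | u′ ∷ [] | N | _ = u′ , N

    both : ∀ {v x y} → v ≢ w → Adj v x → Adj v y → x ≢ y → neighbours v ↭ x ∷ y ∷ []
    both v≢w vx vy x≢y with other v≢w vx
    ... | _ , N with ∈⁻ N vy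
    ...   | here y≡x          = contradiction (sym y≡x) x≢y
    ...   | there (here refl) = N

    -- Otherwise any two vertices are joined through `w` by a walk of length at most 2, against
    -- diameter 3.
    radius≰1 : ¬ (∀ v → v ≡ w ⊎ Adj w v)
    radius≰1 all with proj₂ diam
    ... | u , v , _ , shortest with all u | all v
    ...   | inj₁ refl | inj₁ refl = contradiction (shortest 0 nil) λ ()
    ...   | inj₁ refl | inj₂ wv   = contradiction (shortest 1 (cons wv nil)) λ { (s≤s ()) }
    ...   | inj₂ wu   | inj₁ refl = contradiction (shortest 1 (cons (Adj-sym wu) nil)) λ { (s≤s ()) }
    ...   | inj₂ wu   | inj₂ wv   =
      contradiction (shortest 2 (cons (Adj-sym wu) (cons wv nil))) λ { (s≤s (s≤s ())) }

    -- A neighbour of the hub that lies in no triangle with it; `tip` is where a walk from `w`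
    -- through `a` continues, at distance exactly 2 from `w`.
    record Spoke (a : Vertex) : Set where
      field
        tip     : Vertex
        wa      : Adj w a
        N       : neighbours a ↭ w ∷ tip ∷ []
        outside : ¬ Adj w tip

      a-tip : Adj a tip
      a-tip = ∈⁺ N (there (here refl))

      tip≢w : tip ≢ w
      tip≢w tip≡w with Unique-resp-↭ N (neighbours-unique a)
      ... | (w≢tip ∷ []) ∷ _ = w≢tip (sym tip≡w)

    open Spoke

    mkSpoke : ∀ {a} → Adj w a → (∀ {z} → Adj w z → ¬ Adj a z) → Spoke a
    mkSpoke wa no-chord with other (Adj⇒≢ wa ∘ sym) (Adj-sym wa)
    ... | t , N = record
      { tip = t ; wa = wa ; N = N ; outside = λ wt → no-chord wt (∈⁺ N (there (here refl))) }

    -- A common tip `t` closes a 4-cycle through `w`. Two steps from `t` lead only to `w` or back to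
    -- `t`, and neither is adjacent to the third tip, which is thus out of reach.
    tips-distinct : ∀ {a b c} (A : Spoke a) (B : Spoke b) (C : Spoke c) →
      a ≢ b → a ≢ c → b ≢ c → tip A ≢ tip B
    tips-distinct {a} {b} {c} A B C a≢b a≢c b≢c tA≡tB = far (nearby t (tip C))
      where
      t = tip A
      t-a : Adj t a
      t-a = Adj-sym (a-tip A)
      t-b : Adj t b
      t-b = Adj-sym (subst (Adj b) (sym tA≡tB) (a-tip B))
      Nt : neighbours t ↭ a ∷ b ∷ []
      Nt = both (tip≢w A) t-a t-b a≢b
      ≢₀ : tip C ≢ t
      ≢₀ eq with ∈⁻ Nt (Adj-sym (subst (Adj c) eq (a-tip C)))
      ... | here c≡a         = a≢c (sym c≡a)
      ... | there (here c≡b) = b≢c (sym c≡b)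
      ≢₁ : ¬ Adj t (tip C)
      ≢₁ e with ∈⁻ Nt e
      ... | here eq         = outside C (subst (Adj w) (sym eq) (wa A))
      ... | there (here eq) = outside C (subst (Adj w) (sym eq) (wa B))
      second : ∀ {x y} → Adj t x → Adj x y → y ≡ w ⊎ y ≡ t
      second tx xy with ∈⁻ Nt tx
      ... | here refl with ∈⁻ (N A) xy
      ...   | here eq         = inj₁ eq
      ...   | there (here eq) = inj₂ eq
      second tx xy | there (here refl) with ∈⁻ (N B) xy
      ...   | here eq         = inj₁ eq
      ...   | there (here eq) = inj₂ (trans eq (sym tA≡tB))
      far : ¬ Near t (tip C)
      far (near₀ eq)             = ≢₀ (sym eq)
      far (near₁ e)              = ≢₁ e
      far (near₂ x e e′)         = [ tip≢w C , ≢₀ ]′ (second e e′)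
      far (near₃ x y e e′ e″) with second e e′
      ... | inj₁ refl = outside C e″
      ... | inj₂ refl = ≢₁ e″

    -- Adjacent tips close a 5-cycle through `w`. Two steps from `tip A` lead only to `w`, to `b` or
    -- back, and the third tip is adjacent to none of these.
    tips-nonadjacent : ∀ {a b c} (A : Spoke a) (B : Spoke b) (C : Spoke c) →
      tip A ≢ tip B → tip A ≢ tip C → tip B ≢ tip C → ¬ Adj (tip A) (tip B)
    tips-nonadjacent {a} {b} {c} A B C A≢B A≢C B≢C AB = far (nearby (tip A) (tip C))
      where
      NA : neighbours (tip A) ↭ a ∷ tip B ∷ []
      NA = both (tip≢w A) (Adj-sym (a-tip A)) AB λ eq → outside B (subst (Adj w) eq (wa A))
      NB : neighbours (tip B) ↭ b ∷ tip A ∷ []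
      NB = both (tip≢w B) (Adj-sym (a-tip B)) (Adj-sym AB) λ eq → outside A (subst (Adj w) eq (wa B))
      ≢₁ : ¬ Adj (tip A) (tip C)
      ≢₁ e with ∈⁻ NA e
      ... | here eq         = outside C (subst (Adj w) (sym eq) (wa A))
      ... | there (here eq) = B≢C (sym eq)
      second : ∀ {x y} → Adj (tip A) x → Adj x y → y ≡ w ⊎ y ≡ tip A ⊎ y ≡ b
      second Ax xy with ∈⁻ NA Ax
      ... | here refl with ∈⁻ (N A) xy
      ...   | here eq         = inj₁ eq
      ...   | there (here eq) = inj₂ (inj₁ eq)
      second Ax xy | there (here refl) with ∈⁻ NB xy
      ...   | here eq         = inj₂ (inj₂ eq)
      ...   | there (here eq) = inj₂ (inj₁ eq)
      far : ¬ Near (tip A) (tip C)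
      far (near₀ eq) = A≢C eq
      far (near₁ e)  = ≢₁ e
      far (near₂ x e e′) with second e e′
      ... | inj₁ eq        = tip≢w C eq
      ... | inj₂ (inj₁ eq) = A≢C (sym eq)
      ... | inj₂ (inj₂ eq) = outside C (subst (Adj w) (sym eq) (wa B))
      far (near₃ x y e e′ e″) with second e e′
      ... | inj₁ refl        = outside C e″
      ... | inj₂ (inj₁ refl) = ≢₁ e″
      ... | inj₂ (inj₂ refl) with ∈⁻ (N B) e″
      ...   | here eq         = tip≢w C eq
      ...   | there (here eq) = B≢C (sym eq)

    -- Beyond the tip of A there is a single path e, f, g of vertices at distance at most 3 from
    -- it that avoid the hub; the other three tips must lie on it, none of them at e.
    not-four-spokes : ∀ {a b c d} → Spoke a → Spoke b → Spoke c → Spoke d →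
      a ≢ b → a ≢ c → a ≢ d → b ≢ c → b ≢ d → c ≢ d → ⊥
    not-four-spokes {a} A B C D a≢b a≢c a≢d b≢c b≢d c≢d
      with other (tip≢w A) (Adj-sym (a-tip A))
    ... | e , NA with other {e} {tip A}
                    (λ { refl → outside A (Adj-sym (∈⁺ NA (there (here refl)))) })
                    (Adj-sym (∈⁺ NA (there (here refl))))
    ...   | f , Ne = finish (f ≟ w)
      where
      AB : tip A ≢ tip B
      AB = tips-distinct A B C a≢b a≢c b≢c
      AC : tip A ≢ tip C
      AC = tips-distinct A C B a≢c a≢b (b≢c ∘ sym)
      AD : tip A ≢ tip D
      AD = tips-distinct A D B a≢d a≢b (b≢d ∘ sym)
      BC : tip B ≢ tip C
      BC = tips-distinct B C D b≢c b≢d c≢d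
      BD : tip B ≢ tip D
      BD = tips-distinct B D C b≢d b≢c (c≢d ∘ sym)
      CD : tip C ≢ tip D
      CD = tips-distinct C D B c≢d (b≢c ∘ sym) (b≢d ∘ sym)

      -- A walk that starts with `a` continues to `w`, which is adjacent to no tip, or returns; so a
      -- useful walk passes `e` and is at `f` after two steps.
      reach : ∀ {s} (S : Spoke s) → tip A ≢ tip S → ¬ Adj (tip A) (tip S) → tip S ≡ f ⊎ Adj f (tip S)
      reach S A≢S A≁S with nearby (tip A) (tip S)
      ... | near₀ eq = contradiction eq A≢S
      ... | near₁ e₁ = contradiction e₁ A≁S
      ... | near₂ x e₁ e₂ with ∈⁻ NA e₁
      ...   | here refl with ∈⁻ (N A) e₂
      ...     | here eq         = contradiction eq (tip≢w S)
      ...     | there (here eq) = contradiction (sym eq) A≢S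
      reach S A≢S A≁S | near₂ x e₁ e₂ | there (here refl) with ∈⁻ Ne e₂
      ...     | here eq         = contradiction (sym eq) A≢S
      ...     | there (here eq) = inj₁ eq
      reach S A≢S A≁S | near₃ x y e₁ e₂ e₃ with ∈⁻ NA e₁
      ...   | here refl with ∈⁻ (N A) e₂
      ...     | here refl         = contradiction e₃ (outside S)
      ...     | there (here refl) = contradiction e₃ A≁S
      reach S A≢S A≁S | near₃ x y e₁ e₂ e₃ | there (here refl) with ∈⁻ Ne e₂
      ...     | here refl         = contradiction e₃ A≁S
      ...     | there (here refl) = inj₂ e₃

      A≁B = tips-nonadjacent A B C AB AC BC
      A≁C = tips-nonadjacent A C B AC AB (BC ∘ sym)
      A≁D = tips-nonadjacent A D B AD AB (BD ∘ sym)

      finish : Dec (f ≡ w) → ⊥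
      -- A tip is neither the hub nor adjacent to it.
      finish (yes refl) = [ tip≢w B , outside B ]′ (reach B AB A≁B)
      finish (no f≢w) with other f≢w (Adj-sym (∈⁺ Ne (there (here refl))))
      ... | g , Nf = pigeonhole (on-path B AB A≁B) (on-path C AC A≁C) (on-path D AD A≁D)
        where
        on-path : ∀ {s} (S : Spoke s) → tip A ≢ tip S → ¬ Adj (tip A) (tip S) → tip S ≡ f ⊎ tip S ≡ g
        on-path S A≢S A≁S with reach S A≢S A≁S
        ... | inj₁ eq = inj₁ eq
        ... | inj₂ e₁ with ∈⁻ Nf e₁
        ...   | here refl       = contradiction (∈⁺ NA (there (here refl))) A≁S
        ...   | there (here eq) = inj₂ eq
        pigeonhole : tip B ≡ f ⊎ tip B ≡ g → tip C ≡ f ⊎ tip C ≡ g → tip D ≡ f ⊎ tip D ≡ g → ⊥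
        pigeonhole (inj₁ p) (inj₁ q) _        = BC (trans p (sym q))
        pigeonhole (inj₂ p) (inj₂ q) _        = BC (trans p (sym q))
        pigeonhole (inj₁ p) (inj₂ _) (inj₁ r) = BD (trans p (sym r))
        pigeonhole (inj₁ _) (inj₂ q) (inj₂ r) = CD (trans q (sym r))
        pigeonhole (inj₂ _) (inj₁ q) (inj₁ r) = CD (trans q (sym r))
        pigeonhole (inj₂ p) (inj₁ _) (inj₂ r) = BD (trans p (sym r))

    -- A triangle at the hub.

    module Triangle {a b c d : Vertex} (Nw : neighbours w ↭ a ∷ b ∷ c ∷ d ∷ []) (ab : Adj a b) where

      wa′ : Adj w a
      wa′ = ∈⁺ Nw (here refl)
      wb : Adj w b
      wb = ∈⁺ Nw (there (here refl))
      wc : Adj w c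
      wc = ∈⁺ Nw (there (there (here refl)))
      wd : Adj w d
      wd = ∈⁺ Nw (there (there (there (here refl))))

      Na : neighbours a ↭ w ∷ b ∷ []
      Na = both (Adj⇒≢ wa′ ∘ sym) (Adj-sym wa′) ab (Adj⇒≢ wb)
      Nb : neighbours b ↭ w ∷ a ∷ []
      Nb = both (Adj⇒≢ wb ∘ sym) (Adj-sym wb) (Adj-sym ab) (Adj⇒≢ wa′)

      distinct : Unique (a ∷ b ∷ c ∷ d ∷ [])
      distinct = Unique-resp-↭ Nw (neighbours-unique w)

      a≢c : a ≢ c
      a≢c = case distinct of λ { ((_ ∷ p ∷ _) ∷ _) → p }
      a≢d : a ≢ d
      a≢d = case distinct of λ { ((_ ∷ _ ∷ p ∷ _) ∷ _) → p }
      b≢c : b ≢ c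
      b≢c = case distinct of λ { (_ ∷ (p ∷ _) ∷ _) → p }
      b≢d : b ≢ d
      b≢d = case distinct of λ { (_ ∷ (_ ∷ p ∷ _) ∷ _) → p }
      c≢d : c ≢ d
      c≢d = case distinct of λ { (_ ∷ _ ∷ (p ∷ _) ∷ _) → p }

      only-wb : ∀ {z} → z ≢ w → z ≢ b → ¬ Adj z a
      only-wb z≢w z≢b za with ∈⁻ Na (Adj-sym za)
      ... | here eq         = z≢w eq
      ... | there (here eq) = z≢b eq

      only-wa : ∀ {z} → z ≢ w → z ≢ a → ¬ Adj z b
      only-wa z≢w z≢a zb with ∈⁻ Nb (Adj-sym zb)
      ... | here eq         = z≢w eq
      ... | there (here eq) = z≢a eq

      -- Otherwise two triangles through `w` are closed under adjacency and fill the graph, leaving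
      -- every vertex within distance 1 of `w`.
      c≁d : ¬ Adj c d
      c≁d cd = radius≰1 (closed⇒all _ step (inj₁ refl))
        where
        Nc : neighbours c ↭ w ∷ d ∷ []
        Nc = both (Adj⇒≢ wc ∘ sym) (Adj-sym wc) cd (Adj⇒≢ wd)
        Nd : neighbours d ↭ w ∷ c ∷ []
        Nd = both (Adj⇒≢ wd ∘ sym) (Adj-sym wd) (Adj-sym cd) (Adj⇒≢ wc)
        inside : ∀ {y z} → Adj w y → z ∈ w ∷ y ∷ [] → z ≡ w ⊎ Adj w z
        inside wy (here eq)           = inj₁ eq
        inside wy (there (here refl)) = inj₂ wy
        step : ∀ {y z} → y ≡ w ⊎ Adj w y → Adj y z → z ≡ w ⊎ Adj w z
        step (inj₁ refl) yz = inj₂ yz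
        step (inj₂ wy) yz with ∈⁻ Nw wy
        ... | here refl                         = inside wb (∈⁻ Na yz)
        ... | there (here refl)                 = inside wa′ (∈⁻ Nb yz)
        ... | there (there (here refl))         = inside wd (∈⁻ Nc yz)
        ... | there (there (there (here refl))) = inside wc (∈⁻ Nd yz)

      abstract
        C : Spoke c
        C = mkSpoke wc λ wz cz → case ∈⁻ Nw wz of λ
          { (here refl)                         → only-wb (Adj⇒≢ wc ∘ sym) (b≢c ∘ sym) cz
          ; (there (here refl))                 → only-wa (Adj⇒≢ wc ∘ sym) (a≢c ∘ sym) cz
          ; (there (there (here refl)))         → Adj⇒≢ cz refl
          ; (there (there (there (here refl)))) → c≁d cz }

        D : Spoke d
        D = mkSpoke wd λ wz dz → case ∈⁻ Nw wz of λ
          { (here refl)                         → only-wb (Adj⇒≢ wd ∘ sym) (b≢d ∘ sym) dz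
          ; (there (here refl))                 → only-wa (Adj⇒≢ wd ∘ sym) (a≢d ∘ sym) dz
          ; (there (there (here refl)))         → c≁d (Adj-sym dz)
          ; (there (there (there (here refl)))) → Adj⇒≢ dz refl }

      tip≢ : ∀ {s z} (S : Spoke s) → Adj w z → z ≢ tip S
      tip≢ S wz refl = outside S wz

      -- A triangle and a 4-cycle sharing the hub: the weights force l a + l b = 0 and
      -- l a = l b, which is impossible over ℤ.
      tC≢tD : tip C ≢ tip D
      tC≢tD tC≡tD = l≢0 a (double≡0 (l a) (trans (cong (λ x → l a ℤ.+ x) la≡lb) la+lb≡0))
        where
        open AbelianGroupProperties ℤ.+-0-abelianGroup using (∙-cancelˡ; ∙-cancelʳ)
        l = proj₁ ℤ-magic
        l≢0 = proj₁ (proj₂ ℤ-magic)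
        μ = proj₁ (proj₂ (proj₂ ℤ-magic))
        w≡μ = proj₂ (proj₂ (proj₂ ℤ-magic))
        t = tip C
        Nt : neighbours t ↭ c ∷ d ∷ []
        Nt = both (tip≢w C) (Adj-sym (a-tip C)) (Adj-sym (subst (Adj d) (sym tC≡tD) (a-tip D))) c≢d
        magic : ∀ {v xs} → neighbours v ↭ xs → foldr ℤ._+_ ℤ.0ℤ (map l xs) ≡ μ
        magic {v} p = trans (sym (fold-↭ ℤ.+-0-abelianGroup l p)) (w≡μ v)
        la≡lb : l a ≡ l b
        la≡lb = ∙-cancelʳ ℤ.0ℤ _ _ (∙-cancelˡ (l w) _ _ (trans (magic Nb) (sym (magic Na))))
        la+lb≡0 : l a ℤ.+ l b ≡ ℤ.0ℤ
        -- The hub and the common tip have equal weights; cancelling the labels of `c` and `d`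
        -- leaves those of `a` and `b`.
        la+lb≡0 = ∙-cancelʳ (l c ℤ.+ (l d ℤ.+ ℤ.0ℤ)) _ _
          (trans (ℤ.+-assoc (l a) (l b) _) (trans (magic Nw) (trans (sym (magic Nt)) (sym (ℤ.+-identityˡ _)))))
        double≡0 : ∀ i → i ℤ.+ i ≡ ℤ.0ℤ → i ≡ ℤ.0ℤ
        -- For every other integer, `i + i` computes to a visibly nonzero form, so the hypothesis is
        -- absurd.
        double≡0 (ℤ.+ zero) _ = refl

      -- Otherwise the vertex `e` after `tip C` is at distance at least 3 from `w`. Since `a` and
      -- `b` leave their triangle only through `w`, it is at distance at least 4 from `a`.
      tC-tD : Adj (tip C) (tip D)
      tC-tD with other (tip≢w C) (Adj-sym (a-tip C))
      ... | e , NC with e ≟ tip D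
      ...   | yes refl = ∈⁺ NC (there (here refl))
      ...   | no e≢tD  = contradiction (nearby a e) far
        where
        tCe : Adj (tip C) e
        tCe = ∈⁺ NC (there (here refl))
        e≢w : e ≢ w
        e≢w refl = outside C (Adj-sym tCe)
        e≢c : e ≢ c
        e≢c refl = case Unique-resp-↭ NC (neighbours-unique (tip C)) of λ { ((p ∷ _) ∷ _) → p refl }
        e≢a : e ≢ a
        e≢a refl = only-wb (tip≢w C) (tip≢ C wb ∘ sym) tCe
        e≢b : e ≢ b
        e≢b refl = only-wa (tip≢w C) (tip≢ C wa′ ∘ sym) tCe
        e≢d : e ≢ d
        -- If `e` were `d`, then `tip C` would be the neighbour of `d` other than `w`, which is
        -- `tip D`.
        e≢d refl with ∈⁻ (N D) (Adj-sym tCe)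
        ... | here eq         = tip≢w C eq
        ... | there (here eq) = tC≢tD eq
        ≁w : ¬ Adj w e
        ≁w we with ∈⁻ Nw we
        ... | here eq                         = e≢a eq
        ... | there (here eq)                 = e≢b eq
        ... | there (there (here eq))         = e≢c eq
        ... | there (there (there (here eq))) = e≢d eq
        ≁N[w] : ∀ {y} → Adj w y → ¬ Adj y e
        ≁N[w] wy ye with ∈⁻ Nw wy
        ... | here refl = case ∈⁻ Na ye of λ { (here eq) → e≢w eq ; (there (here eq)) → e≢b eq }
        ... | there (here refl) = case ∈⁻ Nb ye of λ { (here eq) → e≢w eq ; (there (here eq)) → e≢a eq }
        ... | there (there (here refl)) = case ∈⁻ (N C) ye of λ
          { (here eq) → e≢w eq ; (there (here eq)) → Adj⇒≢ tCe (sym eq) }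
        ... | there (there (there (here refl))) = case ∈⁻ (N D) ye of λ
          { (here eq) → e≢w eq ; (there (here eq)) → e≢tD eq }
        far : ¬ Near a e
        far (near₀ eq)   = e≢a (sym eq)
        far (near₁ ae)   = ≁N[w] wa′ ae
        far (near₂ x ax xe) with ∈⁻ Na ax
        ... | here refl         = ≁w xe
        ... | there (here refl) = ≁N[w] wb xe
        far (near₃ x y ax xy ye) with ∈⁻ Na ax
        ... | here refl = ≁N[w] xy ye
        ... | there (here refl) with ∈⁻ Nb xy
        ...   | here refl         = ≁w ye
        ...   | there (here refl) = ≁N[w] wa′ ye

      NtC : neighbours (tip C) ↭ c ∷ tip D ∷ []
      NtC = both (tip≢w C) (Adj-sym (a-tip C)) tC-tD (tip≢ D wc)
      NtD : neighbours (tip D) ↭ d ∷ tip C ∷ []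
      NtD = both (tip≢w D) (Adj-sym (a-tip D)) (Adj-sym tC-tD) (tip≢ C wd)

      -- The order is that of v₁ to v₇: the hub, then around the 5-cycle, then the rest of the
      -- triangle.
      vs : List Vertex
      vs = w ∷ c ∷ tip C ∷ tip D ∷ d ∷ a ∷ b ∷ []

      vs-unique : Unique vs
      vs-unique =
        (Adj⇒≢ wc ∷ tip≢w C ∘ sym ∷ tip≢w D ∘ sym ∷ Adj⇒≢ wd ∷ Adj⇒≢ wa′ ∷ Adj⇒≢ wb ∷ []) ∷
        (tip≢ C wc ∷ tip≢ D wc ∷ c≢d ∷ a≢c ∘ sym ∷ b≢c ∘ sym ∷ []) ∷
        (tC≢tD ∷ tip≢ C wd ∘ sym ∷ tip≢ C wa′ ∘ sym ∷ tip≢ C wb ∘ sym ∷ []) ∷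
        (tip≢ D wd ∘ sym ∷ tip≢ D wa′ ∘ sym ∷ tip≢ D wb ∘ sym ∷ []) ∷
        (a≢d ∘ sym ∷ b≢d ∘ sym ∷ []) ∷
        (Adj⇒≢ ab ∷ []) ∷ [] ∷ []

      at : Fin 7 → Vertex
      at = lookup vs

      -- The neighbourhoods found above leave room for no further edge. This is one half of
      -- `at-adj`, and it also closes the list under adjacency, so that `index` reaches every
      -- vertex.
      at-Adj⁻ : ∀ i {z} → Adj (at i) z → ∃[ k ] T (M₁₁-adj i k) × z ≡ at k
      at-Adj⁻ 0F e = case ∈⁻ Nw e of λ
        { (here eq)                         → 5F , tt , eq
        ; (there (here eq))                 → 6F , tt , eq
        ; (there (there (here eq)))         → 1F , tt , eq
        ; (there (there (there (here eq)))) → 4F , tt , eq }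
      at-Adj⁻ 1F e = case ∈⁻ (N C) e of λ { (here eq) → 0F , tt , eq ; (there (here eq)) → 2F , tt , eq }
      at-Adj⁻ 2F e = case ∈⁻ NtC e of λ { (here eq) → 1F , tt , eq ; (there (here eq)) → 3F , tt , eq }
      at-Adj⁻ 3F e = case ∈⁻ NtD e of λ { (here eq) → 4F , tt , eq ; (there (here eq)) → 2F , tt , eq }
      at-Adj⁻ 4F e = case ∈⁻ (N D) e of λ { (here eq) → 0F , tt , eq ; (there (here eq)) → 3F , tt , eq }
      at-Adj⁻ 5F e = case ∈⁻ Na e of λ { (here eq) → 0F , tt , eq ; (there (here eq)) → 6F , tt , eq }
      at-Adj⁻ 6F e = case ∈⁻ Nb e of λ { (here eq) → 0F , tt , eq ; (there (here eq)) → 5F , tt , eq }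

      at-edges : All (λ (i , j) → Adj (at i) (at j)) M₁₁-edges
      at-edges = wc ∷ a-tip C ∷ tC-tD ∷ Adj-sym (a-tip D) ∷ Adj-sym wd ∷ wa′ ∷ ab ∷ Adj-sym wb ∷ []

      at-Adj⁺ : ∀ i j → T (M₁₁-adj i j) → Adj (at i) (at j)
      at-Adj⁺ i j e with M₁₁-adj⇒∈ i j e
      ... | inj₁ ij = All.lookup at-edges ij
      ... | inj₂ ji = Adj-sym (All.lookup at-edges ji)

      at-adj : ∀ i j → adj (at i) (at j) ≡ M₁₁-adj i j
      at-adj i j = T-injective
        (λ e → case at-Adj⁻ i e of λ { (k , ik , eq) →
           subst (T ∘ M₁₁-adj i) (sym (lookup-injective vs-unique j k eq)) ik })
        (at-Adj⁺ i j)
        where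
        T-injective : ∀ {x y} → (T x → T y) → (T y → T x) → x ≡ y
        T-injective {true}  {true}  _ _ = refl
        T-injective {false} {false} _ _ = refl
        T-injective {true}  {false} f _ = contradiction (f tt) λ ()
        T-injective {false} {true}  _ g = contradiction (g tt) λ ()

      index : ∀ v → ∃[ i ] v ≡ at i
      index = closed⇒all (λ v → ∃[ i ] v ≡ at i)
        (λ { (i , refl) uv → let k , _ , eq = at-Adj⁻ i uv in k , eq }) {w} (0F , refl)

      isomorphism : G ≅ M₁₁⟨0,0⟩
      isomorphism =
        mk↔ₛ′ (proj₁ ∘ index) at
          (λ i → lookup-injective vs-unique _ _ (sym (proj₂ (index (at i)))))
          (λ v → sym (proj₂ (index v))) ,
        λ u v → trans (cong₂ adj (proj₂ (index u)) (proj₂ (index v)))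
                      (at-adj (proj₁ (index u)) (proj₁ (index v)))

    chord⇒≅ : ∀ {a b} → Adj w a → Adj w b → Adj a b → G ≅ M₁₁⟨0,0⟩
    chord⇒≅ {a} {b} wa wb ab with ∈⇒↭ (∈-neighbours⁺ wa)
    ... | xs , N₁ with ∈-resp-↭ N₁ (∈-neighbours⁺ wb)
    ...   | here b≡a = contradiction (sym b≡a) (Adj⇒≢ ab)
    ...   | there b∈xs with ∈⇒↭ b∈xs
    ...     | ys , N₂ with ys | ↭-trans N₁ (prep a N₂) | trans (sym (↭-length (↭-trans N₁ (prep a N₂)))) degree-w
    ...       | c ∷ d ∷ [] | Nw | _ = Triangle.isomorphism Nw ab

    -- Either two neighbours of `w` are adjacent, which gives the triangle, or all four are spokes,
    -- which is impossible.
    ≅M₁₁ : G ≅ M₁₁⟨0,0⟩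
    ≅M₁₁ with any? (λ a → any? (λ b → T? (adj w a) ×-dec T? (adj w b) ×-dec T? (adj a b)))
    ... | yes (a , b , wa , wb , ab) = chord⇒≅ wa wb ab
    ... | no no-chord with length≡4 (neighbours w) degree-w
    ...   | a , b , c , d , eq with subst Unique eq (neighbours-unique w)
    ...     | (a≢b ∷ a≢c ∷ a≢d ∷ []) ∷ (b≢c ∷ b≢d ∷ []) ∷ (c≢d ∷ []) ∷ _ =
      ⊥-elim (not-four-spokes (spoke (here refl)) (spoke (there (here refl)))
        (spoke (there (there (here refl)))) (spoke (there (there (there (here refl)))))
        a≢b a≢c a≢d b≢c b≢d c≢d)
      where
      spoke : ∀ {s} → s ∈ a ∷ b ∷ c ∷ d ∷ [] → Spoke s
      spoke {s} s∈ = mkSpoke ws λ {z} wz sz → no-chord (s , z , ws , wz , sz)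
        where
        ws : Adj w s
        ws = ∈-neighbours⁻ (subst (s ∈_) (sym eq) s∈)

  conclusion : G ≅ M₁₁⟨0,0⟩
  conclusion = let w , degree-w , degree-rest = ∃hub in Hub.≅M₁₁ w degree-w degree-rest

-- The two directions of the equivalence.

theorem4p15 : (c ℓ : Level) (G : Graph) → Bicyclic G → HasDiameter G 3 →
    GroupVertexMagic c ℓ G ⇔ G ≅ M₁₁⟨0,0⟩
theorem4p15 c ℓ G bicyclic diam = mk⇔ necessity
  (λ G≅M₁₁ A nontrivial → VertexMagic-resp-≅ A G M₁₁⟨0,0⟩ G≅M₁₁ (VertexMagic-M₁₁ A nontrivial))
  where
  necessity : GroupVertexMagic c ℓ G → G ≅ M₁₁⟨0,0⟩
  necessity magic with sameParity {G} (GroupVertexMagic⇒VertexMagic {G = G} magic ℤ/2 (true , λ ()))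
  ... | true , odd-degree =
    -- One end of a pair at distance 3 serves as the vertex `v₀`.
    ⊥-elim (OddDegrees.contradictory G (proj₂ bicyclic) (proj₁ (proj₂ diam))
      (GraphProperties.near G diam) odd-degree)
  ... | false , even-degree =
    EvenDegrees.conclusion G bicyclic diam even-degree
      (GroupVertexMagic⇒VertexMagic {G = G} magic ℤ.+-0-abelianGroup (ℤ.1ℤ , λ ()))
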